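{- Let $\mathcal C$ be an updown category, let $\Bbbk$ be a field of characteristic $0$, and let $\Bbbk(\operatorname{Ob}\mathcal C)$ be the free $\Bbbk$-vector space on the set of objects of $\mathcal C$. Let $U,D:\Bbbk(\operatorname{Ob}\mathcal C)\to\Bbbk(\operatorname{Ob}\mathcal C)$ be the linear operators given on objects $p$ by $$Up=\sum_{|p'|=|p|+1}u(p;p')\,p',\qquad Dp=\begin{cases}\sum_{|p'|=|p|-1}d(p';p)\,p',&|p|>0,\\ 0,&p=\hat 0.\end{cases}$$ Then $U$ and $D$ are adjoint with respect to the inner product on $\Bbbk(\operatorname{Ob}\mathcal C)$ (symmetric bilinear form) defined on objects by $$\langle p,p'\rangle=\begin{cases}|\operatorname{Aut}(p)|,&\text{if }p'=p,\\ 0,&\text{otherwise;}\end{cases}$$ that is, $\langle Ux,y\rangle=\langle x,Dy\rangle$ for all $x,y\in\Bbbk(\operatorname{Ob}\mathcal C)$.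
   Context: An updown category is a small category $\mathcal C$ with a rank functor $|\cdot|:\mathcal C\to\mathbb N$ (where $\mathbb N=\{0,1,2,\dots\}$ is the ordered set of natural numbers regarded as a category) such that: (A1) each rank $\mathcal C_n=\{p\in\operatorname{Ob}\mathcal C:|p|=n\}$ is finite; (A2) $\mathcal C_0$ consists of a single object $\hat 0$, and $\operatorname{Hom}(\hat 0,p)$ is nonempty for all objects $p$; (A3) for objects $p,p'$, $\operatorname{Hom}(p,p')$ is always finite, and $\operatorname{Hom}(p,p')=\emptyset$ unless $|p|<|p'|$ or $p=p'$; in the latter case $\operatorname{Hom}(p,p)$ is a group, denoted $\operatorname{Aut}(p)$; (A4) any morphism $p\to p'$ with $|p'|=|p|+k$ factors as a composition $p=p_0\to p_1\to\cdots\to p_k=p'$ with $|p_{i+1}|=|p_i|+1$; (A5) if $|p'|=|p|+1$, the actions of $\operatorname{Aut}(p)$ and $\operatorname{Aut}(p')$ on $\operatorname{Hom}(p,p')$ (by precomposition and postcomposition respectively) are free. For objects $p,p'$ with $|p'|=|p|+1$, set $u(p;p')=|\operatorname{Hom}(p,p')/\operatorname{Aut}(p')|=|\operatorname{Hom}(p,p')|/|\operatorname{Aut}(p')|$ and $d(p;p')=|\operatorname{Hom}(p,p')/\operatorname{Aut}(p)|=|\operatorname{Hom}(p,p')|/|\operatorname{Aut}(p)|$. -}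

module Defs where

open import Level using (Level; _⊔_) renaming (suc to lsuc)
open import Algebra.Apartness.Bundles using (HeytingField; HeytingCommutativeRing)
open import Algebra.Bundles using (CommutativeMonoid; CommutativeRing; Group)
open import Algebra.Module.Bundles using (LeftModule)
open import Algebra.Module.Construct.TensorUnit using () renaming (leftModule to regularModule)
open import Algebra.Module.Morphism.Structures using (module LeftModuleMorphisms)
open import Algebra.Structures using (IsGroup)
import Algebra.Definitions.RawMonoid as RawMonoidDefinitions
import Algebra.Properties.CommutativeSemigroup as CommutativeSemigroupProperties
import Algebra.Properties.Group as GroupProperties
open import Data.Bool.Base using (if_then_else_)
open import Data.Fin.Base using (Fin; zero; suc)
import Data.Fin.Properties as Fin
open import Data.List.Base using (List; []; _∷_; _++_; deduplicate; length; lookup; map; tabulate)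
import Data.List.Membership.Setoid as Membership
open import Data.List.Membership.Setoid.Properties using (∈-deduplicate⁺; ∈-lookup; ∈-resp-≈; ∈-tabulate⁺; index-injective)
open import Data.List.Relation.Unary.All as All using ()
open import Data.List.Relation.Unary.AllPairs using (_∷_)
open import Data.List.Relation.Unary.Any using (index)
open import Data.List.Relation.Unary.Any.Properties using (lookup-index)
open import Data.List.Relation.Unary.Unique.DecSetoid.Properties using (deduplicate-!)
import Data.List.Relation.Unary.Unique.Setoid as UniqueSetoid
open import Data.Nat.Base as ℕ using (ℕ; zero; suc; z≤n; s≤s)
import Data.Nat.Properties as ℕ
open import Data.Product.Base using (Σ; ∃; _×_; _,_; proj₁; proj₂)
open import Data.Sum.Base using (_⊎_)
open import Function.Bundles using (Inverse)
open import Relation.Binary.Bundles using (Setoid; DecSetoid)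
open import Relation.Binary.Core using (Rel)
open import Relation.Binary.Definitions using (Decidable; DecidableEquality)
open import Relation.Binary.PropositionalEquality as ≡ using (_≡_; _≢_)
import Relation.Binary.Reasoning.Setoid as SetoidReasoning
open import Relation.Binary.Structures using (IsEquivalence)
open import Relation.Nullary.Decidable using (Dec; does; yes; no; map′)
open import Relation.Nullary.Negation using (contradiction)

private
  variable
    a b o h ℓ : Level

Finite : Setoid a ℓ → Set (a ⊔ ℓ)
Finite S = ∃ λ n → Inverse S (≡.setoid (Fin n))

∣_∣ : {S : Setoid a ℓ} → Finite S → ℕ
∣ n , _ ∣ = n

module _ {S : Setoid a ℓ} (fin : Finite S) where
  open Setoid S
  open Inverse (proj₂ fin)

  finite-≟ : Decidable _≈_
  finite-≟ x y = map′
    (λ eq → trans (sym (strictlyInverseʳ x)) (trans (from-cong eq) (strictlyInverseʳ y)))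
    to-cong
    (to x Fin.≟ to y)

  finite-any? : ∀ {p} {P : Carrier → Set p} →
                (∀ {x y} → x ≈ y → P x → P y) →
                (∀ x → Dec (P x)) → Dec (∃ P)
  finite-any? resp P? = map′
    (λ (i , p) → from i , p)
    (λ (x , p) → to x , resp (sym (strictlyInverseʳ x)) p)
    (Fin.any? (λ i → P? (from i)))

-- A quotient of a finite set by a decidable equivalence relation is
-- finite; its elements are counted by discarding repetitions.

module _ {S : Setoid a ℓ} (fin : Finite S)
         {_~_ : Rel (Setoid.Carrier S) b} (~-isEquivalence : IsEquivalence _~_)
         (≈⇒~ : ∀ {x y} → Setoid._≈_ S x y → x ~ y) (_~?_ : Decidable _~_)
         where
  open Setoid S using (Carrier)
  private
    T : Setoid _ _
    T = record { isEquivalence = ~-isEquivalence }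

    module T = Setoid T
    open Membership T using (_∈_)
    open UniqueSetoid T using (Unique)
    open Inverse (proj₂ fin)

    lookup-injective : ∀ {xs} → Unique xs → ∀ i j → lookup xs i ~ lookup xs j → i ≡ j
    lookup-injective (_ ∷ _) zero zero _ = ≡.refl
    lookup-injective {_ ∷ xs} (x≁ ∷ _) zero (suc j) x~ =
      contradiction x~ (All.lookupₛ T (λ y~z x≁y x~z → x≁y (T.trans x~z (T.sym y~z))) x≁ (∈-lookup T xs j))
    lookup-injective {_ ∷ xs} (x≁ ∷ _) (suc i) zero ~x =
      contradiction (T.sym ~x) (All.lookupₛ T (λ y~z x≁y x~z → x≁y (T.trans x~z (T.sym y~z))) x≁ (∈-lookup T xs i))
    lookup-injective (_ ∷ u) (suc i) (suc j) eq = ≡.cong suc (lookup-injective u i j eq)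

    classes : List Carrier
    classes = deduplicate _~?_ (tabulate from)

    unique : Unique classes
    unique = deduplicate-! (record { isDecEquivalence = record
      { isEquivalence = ~-isEquivalence ; _≟_ = _~?_ } }) (tabulate from)

    complete : ∀ x → x ∈ classes
    complete x = ∈-deduplicate⁺ T _~?_ (λ z~y x~y → T.trans x~y (T.sym z~y))
      (∈-resp-≈ T (≈⇒~ (strictlyInverseʳ x)) (∈-tabulate⁺ T (to x)))

  quotient-finite : Finite T
  quotient-finite = length classes , record
    { to        = λ x → index (complete x)
    ; from      = lookup classes
    ; to-cong   = λ {x} {y} x~y → lookup-injective unique _ _
                    (T.trans (T.sym (lookup-index (complete x)))
                      (T.trans x~y (lookup-index (complete y))))
    ; from-cong = λ i≡j → T.reflexive (≡.cong (lookup classes) i≡j)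
    ; inverse   =
        (λ {i} {x} x~i → lookup-injective unique _ _
          (T.trans (T.sym (lookup-index (complete x))) x~i))
      , (λ {x} {i} i≡ → T.trans (T.reflexive (≡.cong (lookup classes) i≡))
          (T.sym (lookup-index (complete x))))
    }

record Category o h ℓ : Set (lsuc (o ⊔ h ⊔ ℓ)) where
  infix  4 _≈_
  infixr 9 _∘_
  field
    Ob            : Set o
    Hom           : Ob → Ob → Set h
    _≈_           : ∀ {p q} → Rel (Hom p q) ℓ
    id            : ∀ {p} → Hom p p
    _∘_           : ∀ {p q r} → Hom q r → Hom p q → Hom p r
    isEquivalence : ∀ {p q} → IsEquivalence (_≈_ {p} {q})
    ∘-cong        : ∀ {p q r} {f f′ : Hom q r} {g g′ : Hom p q} →
                    f ≈ f′ → g ≈ g′ → f ∘ g ≈ f′ ∘ g′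
    assoc         : ∀ {p q r s} (f : Hom r s) (g : Hom q r) (k : Hom p q) →
                    (f ∘ g) ∘ k ≈ f ∘ (g ∘ k)
    identityˡ     : ∀ {p q} (f : Hom p q) → id ∘ f ≈ f
    identityʳ     : ∀ {p q} (f : Hom p q) → f ∘ id ≈ f

  homSetoid : Ob → Ob → Setoid h ℓ
  homSetoid p q = record { Carrier = Hom p q ; isEquivalence = isEquivalence }

record RankedCategory o h ℓ : Set (lsuc (o ⊔ h ⊔ ℓ)) where
  field
    category : Category o h ℓ

  open Category category public

  field
    rank      : Ob → ℕ
    -- The poset ℕ is a thin category, so a functor into it is a map on
    -- objects together with this monotonicity.
    rank-mono : ∀ {p q} → Hom p q → rank p ℕ.≤ rank q

  Rank : ℕ → Setoid o o
  Rank n = ≡.setoid (Σ Ob λ p → rank p ≡ n)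

  -- Chain k p q : k composable morphisms, each raising the rank by one.
  data Chain : ℕ → Ob → Ob → Set (o ⊔ h) where
    []  : ∀ {p} → Chain 0 p p
    cons : ∀ {k p q r} → Hom p q → rank q ≡ rank p ℕ.+ 1 → Chain k q r → Chain (suc k) p r

  composite : ∀ {k p q} → Chain k p q → Hom p q
  composite []            = id
  composite (cons f _ fs) = composite fs ∘ f

record UpdownCategory o h ℓ : Set (lsuc (o ⊔ h ⊔ ℓ)) where
  field
    rankedCategory : RankedCategory o h ℓ

  open RankedCategory rankedCategory public

  field
    rank-finite : ∀ n → Finite (Rank n)

    0̂           : Ob
    rank-0̂      : rank 0̂ ≡ 0
    0̂-unique    : ∀ p → rank p ≡ 0 → p ≡ 0̂
    0̂-hom       : ∀ p → Hom 0̂ p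

    hom-finite  : ∀ p q → Finite (homSetoid p q)
    hom-rank    : ∀ {p q} → Hom p q → (rank p ℕ.< rank q) ⊎ (p ≡ q)
    _⁻¹         : ∀ {p} → Hom p p → Hom p p
    aut-isGroup : ∀ p → IsGroup (_≈_ {p} {p}) _∘_ id _⁻¹

    -- Factorisation starts at rank difference one: a morphism of rank
    -- difference zero is an automorphism, whereas the empty chain composes
    -- to the identity only.
    factor      : ∀ {p q} k → rank q ≡ rank p ℕ.+ suc k → (f : Hom p q) →
                  ∃ λ (c : Chain (suc k) p q) → composite c ≈ f

    freeˡ       : ∀ {p q} → rank q ≡ rank p ℕ.+ 1 →
                  (β : Hom q q) (f : Hom p q) → β ∘ f ≈ f → β ≈ id
    freeʳ       : ∀ {p q} → rank q ≡ rank p ℕ.+ 1 →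
                  (α : Hom p p) (f : Hom p q) → f ∘ α ≈ f → α ≈ id

  Aut : Ob → Group h ℓ
  Aut p = record { isGroup = aut-isGroup p }

  ∣Aut_∣ : Ob → ℕ
  ∣Aut p ∣ = ∣ hom-finite p p ∣

  private
    module Eq {p q} = IsEquivalence (isEquivalence {p} {q})
    module G {p} = IsGroup (aut-isGroup p)

  infix 4 _~ˡ_ _~ʳ_

  -- Lying in the same orbit of Aut q, respectively Aut p, on Hom p q.
  _~ˡ_ : ∀ {p q} → Rel (Hom p q) (h ⊔ ℓ)
  _~ˡ_ {p} {q} f g = ∃ λ (β : Hom q q) → β ∘ f ≈ g

  _~ʳ_ : ∀ {p q} → Rel (Hom p q) (h ⊔ ℓ)
  _~ʳ_ {p} {q} f g = ∃ λ (α : Hom p p) → f ∘ α ≈ g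

  ~ˡ-isEquivalence : ∀ {p q} → IsEquivalence (_~ˡ_ {p} {q})
  ~ˡ-isEquivalence = record
    { refl  = id , identityˡ _
    ; sym   = λ {f} (β , βf≈g) → β ⁻¹ ,
        Eq.trans (∘-cong Eq.refl (Eq.sym βf≈g))
          (Eq.trans (Eq.sym (assoc _ _ _))
            (Eq.trans (∘-cong (G.inverseˡ β) Eq.refl) (identityˡ f)))
    ; trans = λ (β , βf≈g) (γ , γg≈h) → γ ∘ β ,
        Eq.trans (assoc _ _ _) (Eq.trans (∘-cong Eq.refl βf≈g) γg≈h)
    }

  ~ʳ-isEquivalence : ∀ {p q} → IsEquivalence (_~ʳ_ {p} {q})
  ~ʳ-isEquivalence = record
    { refl  = id , identityʳ _
    ; sym   = λ {f} (α , fα≈g) → α ⁻¹ ,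
        Eq.trans (∘-cong (Eq.sym fα≈g) Eq.refl)
          (Eq.trans (assoc _ _ _)
            (Eq.trans (∘-cong Eq.refl (G.inverseʳ α)) (identityʳ f)))
    ; trans = λ (α , fα≈g) (γ , gγ≈h) → α ∘ γ ,
        Eq.trans (Eq.sym (assoc _ _ _)) (Eq.trans (∘-cong fα≈g Eq.refl) gγ≈h)
    }

  Hom/Autˡ : Ob → Ob → Setoid h (h ⊔ ℓ)
  Hom/Autˡ p q = record { isEquivalence = ~ˡ-isEquivalence {p} {q} }

  Hom/Autʳ : Ob → Ob → Setoid h (h ⊔ ℓ)
  Hom/Autʳ p q = record { isEquivalence = ~ʳ-isEquivalence {p} {q} }

  Hom/Autˡ-finite : ∀ p q → Finite (Hom/Autˡ p q)
  Hom/Autˡ-finite p q = quotient-finite (hom-finite p q) ~ˡ-isEquivalence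
    (λ f≈g → id , Eq.trans (identityˡ _) f≈g)
    (λ f g → finite-any? (hom-finite q q)
      (λ α≈β αf≈g → Eq.trans (∘-cong (Eq.sym α≈β) Eq.refl) αf≈g)
      (λ β → finite-≟ (hom-finite p q) (β ∘ f) g))

  Hom/Autʳ-finite : ∀ p q → Finite (Hom/Autʳ p q)
  Hom/Autʳ-finite p q = quotient-finite (hom-finite p q) ~ʳ-isEquivalence
    (λ f≈g → id , Eq.trans (identityʳ _) f≈g)
    (λ f g → finite-any? (hom-finite p p)
      (λ α≈β fα≈g → Eq.trans (∘-cong Eq.refl (Eq.sym α≈β)) fα≈g)
      (λ α → finite-≟ (hom-finite p q) (f ∘ α) g))

  -- Numbers of orbits, meaningful when rank q ≡ rank p + 1.
  u : Ob → Ob → ℕ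
  u p q = ∣ Hom/Autˡ-finite p q ∣

  d : Ob → Ob → ℕ
  d p q = ∣ Hom/Autʳ-finite p q ∣

  infix 4 _≟_

  _≟_ : DecidableEquality Ob
  p ≟ q with rank q ℕ.≟ rank p
  ... | no  rq≢rp = no λ p≡q → rq≢rp (≡.cong rank (≡.sym p≡q))
  ... | yes rq≡rp = map′ (≡.cong proj₁) (same-rank rq≡rp)
                      (finite-≟ (rank-finite (rank p)) (p , ≡.refl) (q , rq≡rp))
    where
    same-rank : ∀ {p q} (eq : rank q ≡ rank p) → p ≡ q →
                _≡_ {A = Σ Ob λ r → rank r ≡ rank p} (p , ≡.refl) (q , eq)
    same-rank eq ≡.refl = ≡.cong (_ ,_) (ℕ.≡-irrelevant _ _)

module FreeModule {c ℓ′ x} (R : CommutativeRing c ℓ′) {X : Set x}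
                  (_≟_ : DecidableEquality X) where

  private
    module R = CommutativeRing R
    open R using (_≈_; _+_; _*_; -_; 0#; 1#)
    module +-Props = CommutativeSemigroupProperties
      (CommutativeMonoid.commutativeSemigroup R.+-commutativeMonoid)
    module *-Props = CommutativeSemigroupProperties
      (CommutativeMonoid.commutativeSemigroup R.*-commutativeMonoid)

  -- Formal linear combinations, two of which are equal when they have
  -- the same coefficients.
  Combination : Set (c ⊔ x)
  Combination = List (R.Carrier × X)

  δ : X → X → R.Carrier
  δ p q = if does (p ≟ q) then 1# else 0#

  coeff : Combination → X → R.Carrier
  coeff []            q = 0#
  coeff ((c , p) ∷ v) q = c * δ p q + coeff v q

  scale : R.Carrier → Combination → Combination
  scale c = map λ (c′ , p) → c * c′ , p

  infix 4 _≋_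
  _≋_ : Rel Combination (x ⊔ ℓ′)
  v ≋ w = ∀ q → coeff v q ≈ coeff w q

  coeff-++ : ∀ v w q → coeff (v ++ w) q ≈ coeff v q + coeff w q
  coeff-++ []            w q = R.sym (R.+-identityˡ _)
  coeff-++ ((c , p) ∷ v) w q = R.trans (R.+-congˡ (coeff-++ v w q)) (R.sym (R.+-assoc _ _ _))

  coeff-scale : ∀ c v q → coeff (scale c v) q ≈ c * coeff v q
  coeff-scale c []             q = R.sym (R.zeroʳ c)
  coeff-scale c ((c′ , p) ∷ v) q =
    R.trans (R.+-cong (R.*-assoc _ _ _) (coeff-scale c v q)) (R.sym (R.distribˡ _ _ _))

  free : LeftModule R.ring (c ⊔ x) (x ⊔ ℓ′)
  free = record
    { Carrierᴹ = Combination
    ; _≈ᴹ_     = _≋_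
    ; _+ᴹ_     = _++_
    ; _*ₗ_     = scale
    ; 0ᴹ       = []
    ; -ᴹ_      = scale (- 1#)
    ; isLeftModule = record
      { isLeftSemimodule = record
        { +ᴹ-isCommutativeMonoid = record
          { isMonoid = record
            { isSemigroup = record
              { isMagma = record
                { isEquivalence = record
                  { refl  = λ _ → R.refl
                  ; sym   = λ eq q → R.sym (eq q)
                  ; trans = λ eq eq′ q → R.trans (eq q) (eq′ q)
                  }
                ; ∙-cong = λ {v} {v′} {w} {w′} eq eq′ q →
                    via (coeff-++ v w q) (R.+-cong (eq q) (eq′ q)) (coeff-++ v′ w′ q)
                }
              ; assoc = λ u v w q →
                  via (R.trans (coeff-++ (u ++ v) w q) (R.+-congʳ (coeff-++ u v q)))
                      (R.+-assoc _ _ _)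
                      (R.trans (coeff-++ u (v ++ w) q) (R.+-congˡ (coeff-++ v w q)))
              }
            ; identity =
                (λ _ _ → R.refl)
              , (λ v q → R.trans (coeff-++ v [] q) (R.+-identityʳ _))
            }
          ; comm = λ v w q → via (coeff-++ v w q) (R.+-comm _ _) (coeff-++ w v q)
          }
        ; isPreleftSemimodule = record
          { *ₗ-cong      = λ {c} {c′} {v} {v′} c≈c′ eq q →
              via (coeff-scale c v q) (R.*-cong c≈c′ (eq q)) (coeff-scale c′ v′ q)
          ; *ₗ-zeroˡ     = λ v q → R.trans (coeff-scale 0# v q) (R.zeroˡ _)
          ; *ₗ-distribʳ  = λ v c c′ q →
              via (coeff-scale (c + c′) v q) (R.distribʳ _ _ _)
                  (R.trans (coeff-++ (scale c v) (scale c′ v) q)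
                    (R.+-cong (coeff-scale c v q) (coeff-scale c′ v q)))
          ; *ₗ-identityˡ = λ v q → R.trans (coeff-scale 1# v q) (R.*-identityˡ _)
          ; *ₗ-assoc     = λ c c′ v q →
              via (coeff-scale (c * c′) v q) (R.*-assoc _ _ _)
                  (R.trans (coeff-scale c (scale c′ v) q) (R.*-congˡ (coeff-scale c′ v q)))
          ; *ₗ-zeroʳ     = λ _ _ → R.refl
          ; *ₗ-distribˡ  = λ c v w q →
              via (R.trans (coeff-scale c (v ++ w) q) (R.*-congˡ (coeff-++ v w q)))
                  (R.distribˡ _ _ _)
                  (R.trans (coeff-++ (scale c v) (scale c w) q)
                    (R.+-cong (coeff-scale c v q) (coeff-scale c w q)))
          }
        }
      ; -ᴹ‿cong    = λ {v} {v′} eq q →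
          via (coeff-scale (- 1#) v q) (R.*-congˡ (eq q)) (coeff-scale (- 1#) v′ q)
      ; -ᴹ‿inverse =
          (λ v q → R.trans (coeff-++ (scale (- 1#) v) v q) (R.trans
            (R.+-cong (coeff-scale (- 1#) v q) (R.sym (R.*-identityˡ _)))
            (cancel (R.-‿inverseˡ 1#))))
        , (λ v q → R.trans (coeff-++ v (scale (- 1#) v) q) (R.trans
            (R.+-cong (R.sym (R.*-identityˡ _)) (coeff-scale (- 1#) v q))
            (cancel (R.-‿inverseʳ 1#))))
      }
    }
    where
    via : ∀ {s s′ t t′} → s ≈ s′ → s′ ≈ t′ → t ≈ t′ → s ≈ t
    via s≈ eq t≈ = R.trans s≈ (R.trans eq (R.sym t≈))
    cancel : ∀ {s t z} → s + t ≈ 0# → s * z + t * z ≈ 0#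
    cancel eq = R.trans (R.sym (R.distribʳ _ _ _)) (R.trans (R.*-congʳ eq) (R.zeroˡ _))

  basis : X → Combination
  basis p = (1# , p) ∷ []

  module _ {m ℓm} (M : LeftModule R.ring m ℓm) where
    open LeftModule M
    open LeftModuleMorphisms (LeftModule.rawLeftModule free) rawLeftModule
      using (IsLeftModuleHomomorphism)
    open SetoidReasoning ≈ᴹ-setoid
    private
      module +ᴹ-Props = CommutativeSemigroupProperties
        (CommutativeMonoid.commutativeSemigroup +ᴹ-commutativeMonoid)
      module GroupP = GroupProperties +ᴹ-group

    -- The linear map determined by its values on the basis.
    extend : (X → Carrierᴹ) → Combination → Carrierᴹ
    extend g []            = 0ᴹ
    extend g ((c , p) ∷ v) = c *ₗ g p +ᴹ extend g v

    module _ (g : X → Carrierᴹ) where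

      extend-basis : ∀ p → extend g (basis p) ≈ᴹ g p
      extend-basis p = ≈ᴹ-trans (+ᴹ-identityʳ _) (*ₗ-identityˡ _)

      extend-++ : ∀ v w → extend g (v ++ w) ≈ᴹ extend g v +ᴹ extend g w
      extend-++ []            w = ≈ᴹ-sym (+ᴹ-identityˡ _)
      extend-++ ((c , p) ∷ v) w = ≈ᴹ-trans (+ᴹ-congˡ (extend-++ v w)) (≈ᴹ-sym (+ᴹ-assoc _ _ _))

      extend-scale : ∀ c v → extend g (scale c v) ≈ᴹ c *ₗ extend g v
      extend-scale c []             = ≈ᴹ-sym (*ₗ-zeroʳ c)
      extend-scale c ((c′ , p) ∷ v) =
        ≈ᴹ-trans (+ᴹ-cong (*ₗ-assoc _ _ _) (extend-scale c v)) (≈ᴹ-sym (*ₗ-distribˡ _ _ _))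

      private
        remove : X → Combination → Combination
        remove q []            = []
        remove q ((c , p) ∷ v) = if does (p ≟ q) then remove q v else (c , p) ∷ remove q v

        remove-length : ∀ q v → length (remove q v) ℕ.≤ length v
        remove-length q []            = z≤n
        remove-length q ((c , p) ∷ v) with p ≟ q
        ... | yes _ = ℕ.m≤n⇒m≤1+n (remove-length q v)
        ... | no  _ = s≤s (remove-length q v)

        δ-refl : ∀ p → δ p p ≡ 1#
        δ-refl p with p ≟ p
        ... | yes _   = ≡.refl
        ... | no  p≢p = contradiction ≡.refl p≢p

        δ-≢ : ∀ {p q} → p ≢ q → δ p q ≡ 0#
        δ-≢ {p} {q} p≢q with p ≟ q
        ... | yes p≡q = contradiction p≡q p≢q
        ... | no  _   = ≡.refl

        drop-zero : ∀ {s t z} → t ≡ 0# → s * t + z ≈ z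
        drop-zero ≡.refl = R.trans (R.+-congʳ (R.zeroʳ _)) (R.+-identityˡ _)

        coeff-remove-≡ : ∀ q v → coeff (remove q v) q ≈ 0#
        coeff-remove-≡ q []            = R.refl
        coeff-remove-≡ q ((c , p) ∷ v) with p ≟ q
        ... | yes _   = coeff-remove-≡ q v
        ... | no  p≢q = R.trans (drop-zero (δ-≢ p≢q)) (coeff-remove-≡ q v)

        coeff-remove-≢ : ∀ {q r} v → q ≢ r → coeff (remove q v) r ≈ coeff v r
        coeff-remove-≢ []            _   = R.refl
        coeff-remove-≢ {q} ((c , p) ∷ v) q≢r with p ≟ q
        ... | yes ≡.refl = R.trans (coeff-remove-≢ v q≢r) (R.sym (drop-zero (δ-≢ q≢r)))
        ... | no  _      = R.+-congˡ (coeff-remove-≢ v q≢r)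

        extend-remove : ∀ q v → extend g v ≈ᴹ coeff v q *ₗ g q +ᴹ extend g (remove q v)
        extend-remove q []            = ≈ᴹ-sym (≈ᴹ-trans (+ᴹ-identityʳ _) (*ₗ-zeroˡ _))
        extend-remove q ((c , p) ∷ v) with p ≟ q
        ... | yes ≡.refl = begin
          c *ₗ g p +ᴹ extend g v
            ≈⟨ +ᴹ-cong (*ₗ-congʳ (R.sym (R.*-identityʳ c))) (extend-remove p v) ⟩
          (c * 1#) *ₗ g p +ᴹ (coeff v p *ₗ g p +ᴹ extend g (remove p v))
            ≈⟨ +ᴹ-assoc _ _ _ ⟨
          ((c * 1#) *ₗ g p +ᴹ coeff v p *ₗ g p) +ᴹ extend g (remove p v)
            ≈⟨ +ᴹ-congʳ (*ₗ-distribʳ _ _ _) ⟨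
          (c * 1# + coeff v p) *ₗ g p +ᴹ extend g (remove p v) ∎
        ... | no p≢q = begin
          c *ₗ g p +ᴹ extend g v
            ≈⟨ +ᴹ-congˡ (extend-remove q v) ⟩
          c *ₗ g p +ᴹ (coeff v q *ₗ g q +ᴹ extend g (remove q v))
            ≈⟨ +ᴹ-Props.x∙yz≈y∙xz _ _ _ ⟩
          coeff v q *ₗ g q +ᴹ (c *ₗ g p +ᴹ extend g (remove q v))
            ≈⟨ +ᴹ-congʳ (*ₗ-congʳ (drop-zero ≡.refl)) ⟨
          (c * 0# + coeff v q) *ₗ g q +ᴹ (c *ₗ g p +ᴹ extend g (remove q v)) ∎

        extend-zero : ∀ n v → length v ℕ.≤ n → v ≋ [] → extend g v ≈ᴹ 0ᴹ
        extend-zero _       []              _         _   = ≈ᴹ-refl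
        extend-zero (suc n) w@((c , q) ∷ v) (s≤s v≤n) w≋0 = begin
          extend g w                                   ≈⟨ extend-remove q w ⟩
          coeff w q *ₗ g q +ᴹ extend g (remove q w)    ≈⟨ +ᴹ-cong (*ₗ-congʳ (w≋0 q))
                                                            (extend-zero n (remove q w) (short (q ≟ q)) zero′) ⟩
          0# *ₗ g q +ᴹ 0ᴹ                              ≈⟨ +ᴹ-identityʳ _ ⟩
          0# *ₗ g q                                    ≈⟨ *ₗ-zeroˡ _ ⟩
          0ᴹ                                           ∎
          where
          short : Dec (q ≡ q) → length (remove q w) ℕ.≤ n
          short _ with q ≟ q
          ... | yes _   = ℕ.≤-trans (remove-length q v) v≤n
          ... | no  q≢q = contradiction ≡.refl q≢q
          zero′ : remove q w ≋ []
          zero′ r with q ≟ r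
          ... | yes ≡.refl = coeff-remove-≡ q w
          ... | no  q≢r    = R.trans (coeff-remove-≢ w q≢r) (w≋0 r)

        extend-neg : ∀ v → extend g (scale (- 1#) v) ≈ᴹ -ᴹ extend g v
        extend-neg v = GroupP.inverseˡ-unique _ _ (begin
          extend g (scale (- 1#) v) +ᴹ extend g v   ≈⟨ extend-++ (scale (- 1#) v) v ⟨
          extend g (scale (- 1#) v ++ v)            ≈⟨ extend-zero _ (scale (- 1#) v ++ v) ℕ.≤-refl (LeftModule.-ᴹ‿inverseˡ free v) ⟩
          0ᴹ                                        ∎)

      extend-cong : ∀ {v w} → v ≋ w → extend g v ≈ᴹ extend g w
      extend-cong {v} {w} v≋w = GroupP.x∙y⁻¹≈ε⇒x≈y _ _ (begin
        extend g v +ᴹ -ᴹ extend g w                ≈⟨ +ᴹ-congˡ (extend-neg w) ⟨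
        extend g v +ᴹ extend g (scale (- 1#) w)    ≈⟨ extend-++ v _ ⟨
        extend g (v ++ scale (- 1#) w)             ≈⟨ extend-zero _ (v ++ scale (- 1#) w) ℕ.≤-refl
                                                        (GroupProperties.x≈y⇒x∙y⁻¹≈ε (LeftModule.+ᴹ-group free) {v} {w} v≋w) ⟩
        0ᴹ                                         ∎)

      extend-isLinear : IsLeftModuleHomomorphism (extend g)
      extend-isLinear = record
        { +ᴹ-isGroupHomomorphism = record
          { isMonoidHomomorphism = record
            { isMagmaHomomorphism = record
              { isRelHomomorphism = record { cong = λ {v} {w} → extend-cong {v} {w} }
              ; homo              = extend-++
              }
            ; ε-homo = ≈ᴹ-refl
            }
          ; ⁻¹-homo = extend-neg
          }
        ; *ₗ-homo = extend-scale
        }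

  -- The bilinear form determined by its values on pairs of basis elements.
  bilinear : (X → X → R.Carrier) → Combination → Combination → R.Carrier
  bilinear g v w = extend regularModule (λ p → extend regularModule (g p) w) v

  module _ where
    open LeftModuleMorphisms (LeftModule.rawLeftModule free) (LeftModule.rawLeftModule (regularModule {R = R.ring}))
      using (IsLeftModuleHomomorphism)
    open SetoidReasoning R.setoid

    bilinear-isLinearˡ : ∀ g w → IsLeftModuleHomomorphism (λ v → bilinear g v w)
    bilinear-isLinearˡ g w = extend-isLinear regularModule _

    private
      row : (X → R.Carrier) → Combination → R.Carrier
      row = extend regularModule

      row-zero : ∀ w → row (λ _ → 0#) w ≈ 0#
      row-zero []            = R.refl
      row-zero ((c , p) ∷ w) = R.trans (R.+-cong (R.zeroʳ c) (row-zero w)) (R.+-identityʳ 0#)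

      row-step : ∀ c s t w → row (λ q → c * s q + t q) w ≈ c * row s w + row t w
      row-step c s t []             = R.sym (R.trans (R.+-identityʳ _) (R.zeroʳ c))
      row-step c s t ((c′ , q) ∷ w) = begin
        c′ * (c * s q + t q) + row (λ q → c * s q + t q) w
          ≈⟨ R.+-cong (R.distribˡ _ _ _) (row-step c s t w) ⟩
        (c′ * (c * s q) + c′ * t q) + (c * row s w + row t w)
          ≈⟨ +-Props.interchange _ _ _ _ ⟩
        (c′ * (c * s q) + c * row s w) + (c′ * t q + row t w)
          ≈⟨ R.+-congʳ (R.+-congʳ (*-Props.x∙yz≈y∙xz c′ c (s q))) ⟩
        (c * (c′ * s q) + c * row s w) + (c′ * t q + row t w)
          ≈⟨ R.+-congʳ (R.distribˡ _ _ _) ⟨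
        c * (c′ * s q + row s w) + (c′ * t q + row t w) ∎

      row-cong : ∀ {s t} → (∀ q → s q ≈ t q) → ∀ w → row s w ≈ row t w
      row-cong s≈t []            = R.refl
      row-cong s≈t ((c , q) ∷ w) = R.+-cong (R.*-congˡ (s≈t q)) (row-cong s≈t w)

    bilinear-sym : ∀ {g} → (∀ p q → g p q ≈ g q p) →
                   ∀ v w → bilinear g v w ≈ bilinear g w v
    bilinear-sym         g-sym []            w = R.sym (row-zero w)
    bilinear-sym {g = g} g-sym ((c , p) ∷ v) w = begin
      c * row (g p) w + bilinear g v w
        ≈⟨ R.+-cong (R.*-congˡ (row-cong (g-sym p) w)) (bilinear-sym g-sym v w) ⟩
      c * row (λ q → g q p) w + row (λ q → row (g q) v) w
        ≈⟨ row-step c _ _ w ⟨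
      row (λ q → c * g q p + row (g q) v) w ∎

module _ {c ℓ₁ ℓ₂} (k : HeytingField c ℓ₁ ℓ₂) where

  fieldRing : CommutativeRing c ℓ₁
  fieldRing = HeytingCommutativeRing.commutativeRing (HeytingField.heytingCommutativeRing k)

  open CommutativeRing fieldRing hiding (zero) renaming (_≈_ to _≈ₖ_)
  open RawMonoidDefinitions +-rawMonoid using () renaming (_×_ to _·_)

  CharacteristicZero : Set ℓ₁
  CharacteristicZero = ∀ n → n · 1# ≈ₖ 0# → n ≡ 0

  module Operators (C : UpdownCategory o h ℓ) where
    open UpdownCategory C
    open FreeModule fieldRing _≟_ public

    k[Ob] : LeftModule ring (c ⊔ o) (o ⊔ ℓ₁)
    k[Ob] = free

    open LeftModule k[Ob] using (Carrierᴹ; 0ᴹ; _*ₗ_; +ᴹ-rawMonoid; rawLeftModule)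
    open LeftModuleMorphisms rawLeftModule rawLeftModule using (IsLeftModuleHomomorphism)
    open RawMonoidDefinitions +ᴹ-rawMonoid using (sum)

    ∑Rank : ℕ → (Ob → Carrierᴹ) → Carrierᴹ
    ∑Rank n t = sum (λ i → t (proj₁ (Inverse.from (proj₂ (rank-finite n)) i)))

    U-ob : Ob → Carrierᴹ
    U-ob p = ∑Rank (rank p ℕ.+ 1) λ p′ → (u p p′ · 1#) *ₗ basis p′

    D-ob : Ob → Carrierᴹ
    D-ob p with rank p
    ... | zero  = 0ᴹ
    ... | suc n = ∑Rank n λ p′ → (d p′ p · 1#) *ₗ basis p′

    U : Carrierᴹ → Carrierᴹ
    U = extend k[Ob] U-ob

    D : Carrierᴹ → Carrierᴹ
    D = extend k[Ob] D-ob

    U-isLinear : IsLeftModuleHomomorphism U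
    U-isLinear = extend-isLinear k[Ob] U-ob

    D-isLinear : IsLeftModuleHomomorphism D
    D-isLinear = extend-isLinear k[Ob] D-ob

    ⟨_,_⟩-ob : Ob → Ob → Carrier
    ⟨ p , p′ ⟩-ob = if does (p′ ≟ p) then ∣Aut p ∣ · 1# else 0#

    ⟨_,_⟩ : Carrierᴹ → Carrierᴹ → Carrier
    ⟨_,_⟩ = bilinear ⟨_,_⟩-ob

    ⟨⟩-sym : ∀ x y → ⟨ x , y ⟩ ≈ₖ ⟨ y , x ⟩
    ⟨⟩-sym = bilinear-sym ob-sym
      where
      ob-sym : ∀ p q → ⟨ p , q ⟩-ob ≈ₖ ⟨ q , p ⟩-ob
      ob-sym p q with p ≟ q | q ≟ p
      ... | yes ≡.refl | yes _   = refl
      ... | yes p≡q    | no  q≢p = contradiction (≡.sym p≡q) q≢p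
      ... | no  p≢q    | yes q≡p = contradiction (≡.sym q≡p) p≢q
      ... | no  _      | no  _   = refl

{-# OPTIONS --safe #-}

-- On basis elements both sides count morphisms. If |q| = |p| + 1, the free
-- action of Aut q cuts Hom p q into u(p;q) orbits of size |Aut q|, so
-- ⟨Up, q⟩ = u(p;q) |Aut q| = |Hom(p,q)|; the free action of Aut p gives
-- likewise ⟨p, Dq⟩ = d(p;q) |Aut p| = |Hom(p,q)|. Otherwise both sides vanish.

module Submission where

open import Defs
open import Level using (Level)
open import Algebra.Apartness.Bundles using (HeytingField)
open import Algebra.Bundles using (CommutativeMonoid; CommutativeRing; Group)
open import Algebra.Module.Bundles using (LeftModule)
open import Algebra.Module.Construct.TensorUnit using () renaming (leftModule to regularModule)
import Algebra.Definitions.RawMonoid as RawMonoidDefinitions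
import Algebra.Properties.CommutativeMonoid.Sum as CommutativeMonoidSum
import Algebra.Properties.Group as GroupProperties
import Algebra.Properties.Semiring.Mult as SemiringMult
open import Data.Fin.Base using (Fin)
open import Data.Fin.Permutation using (↔⇒≡)
open import Data.Fin.Properties using (*↔×; punchInᵢ≢i)
open import Data.List.Base using ([]; _∷_)
open import Data.Nat.Base as ℕ using (ℕ; zero; suc)
import Data.Nat.Properties as ℕ
open import Data.Product.Base using (∃; _×_; _,_; proj₁; proj₂)
open import Function.Base using (_∘_)
open import Function.Bundles using (Inverse; _⤖_; mk⤖)
open import Function.Consequences.Propositional using (strictlySurjective⇒surjective)
open import Function.Construct.Composition using (_↔-∘_)
open import Function.Properties.Bijection using (⤖⇒↔)
open import Relation.Binary.Bundles using (Setoid)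
open import Relation.Binary.PropositionalEquality as ≡ using (_≡_; _≢_)
import Relation.Binary.Reasoning.Setoid as SetoidReasoning
open import Relation.Binary.Structures using (IsEquivalence)
open import Relation.Nullary.Decidable using (yes; no)
open import Relation.Nullary.Negation using (contradiction)

private
  variable
    a b o h ℓ ℓ′ c ℓ₁ ℓ₂ : Level

-- Orbit counting for free actions.

module _ {A : Setoid a ℓ} {S : Setoid b ℓ′} where
  private
    module A = Setoid A
    module S = Setoid S

  -- Fix a representative of each orbit; sending an orbit and a group element to the translate of
  -- that representative is a bijection onto the set. The group structure enters through `orbit`, so
  -- that postcomposition and precomposition are both covered.
  ∣set∣≡∣orbits∣*∣group∣ :
    (_·_ : A.Carrier → S.Carrier → S.Carrier) →
    (∀ {α β} x → α A.≈ β → (α · x) S.≈ (β · x)) →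
    (∀ {α β} x → (α · x) S.≈ (β · x) → α A.≈ β) →
    (orbit : IsEquivalence (λ x y → ∃ λ α → (α · x) S.≈ y)) →
    (finA : Finite A) (finS : Finite S)
    (finQ : Finite (record { isEquivalence = orbit })) →
    ∣ finS ∣ ≡ ∣ finQ ∣ ℕ.* ∣ finA ∣
  ∣set∣≡∣orbits∣*∣group∣ _·_ ·-congʳ free orbit (m , A↔m) (n , S↔n) (l , Q↔l) =
    ≡.sym (↔⇒≡ (⤖⇒↔ pairs⤖elements ↔-∘ *↔× {l} {m}))
    where
    module A↔ = Inverse A↔m
    module S↔ = Inverse S↔n
    module Q↔ = Inverse Q↔l

    element : Fin l × Fin m → S.Carrier
    element (i , j) = A↔.from j · Q↔.from i

    element-injective : ∀ {x y} → element x S.≈ element y → x ≡ y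
    element-injective {i , j} {i′ , j′} eq with i≡i′
      where
      open IsEquivalence orbit
      i≡i′ : i ≡ i′
      i≡i′ = ≡.trans (≡.sym (Q↔.strictlyInverseˡ i)) (≡.trans
        -- Both representatives lie in the orbit of the common element, which forces equal indices;
        -- freeness then compares the group elements.
        (Q↔.to-cong (trans (A↔.from j , eq) (sym (A↔.from j′ , S.refl))))
        (Q↔.strictlyInverseˡ i′))
    ... | ≡.refl = ≡.cong (i ,_)
      (≡.trans (≡.sym (A↔.strictlyInverseˡ j)) (≡.trans
        (A↔.to-cong (free (Q↔.from i) eq))
        (A↔.strictlyInverseˡ j′)))

    element-surjective : ∀ x → ∃ λ ij → element ij S.≈ x
    -- Equality in the quotient carries a witness: here, an `α` moving the chosen representative to
    -- `x`.
    element-surjective x with Q↔.strictlyInverseʳ x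
    ... | α , αr≈x = (Q↔.to x , A↔.to α) ,
      S.trans (·-congʳ _ (A↔.strictlyInverseʳ α)) αr≈x

    pairs⤖elements : (Fin l × Fin m) ⤖ Fin n
    pairs⤖elements = mk⤖ {to = S↔.to ∘ element}
      ( (λ eq → element-injective (S.trans (S.sym (S↔.strictlyInverseʳ _))
          (S.trans (S↔.from-cong eq) (S↔.strictlyInverseʳ _))))
      , strictlySurjective⇒surjective (λ k →
          let ij , eq = element-surjective (S↔.from k)
          in ij , ≡.trans (S↔.to-cong eq) (S↔.strictlyInverseˡ k)))

-- Counting morphisms between adjacent ranks.

module _ (C : UpdownCategory o h ℓ) where
  open UpdownCategory C hiding (_∘_; _≈_)
  open Category category using () renaming (_∘_ to _⊚_; _≈_ to _≋ₕ_)
  private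
    module H {p q} = Setoid (homSetoid p q)

  ∣Hom∣≡u*∣Aut∣ : ∀ {p q} → rank q ≡ rank p ℕ.+ 1 →
                  ∣ hom-finite p q ∣ ≡ u p q ℕ.* ∣Aut q ∣
  ∣Hom∣≡u*∣Aut∣ {p} {q} eq = ∣set∣≡∣orbits∣*∣group∣ _⊚_
    (λ f β≈γ → ∘-cong β≈γ H.refl) cancel ~ˡ-isEquivalence
    (hom-finite q q) (hom-finite p q) (Hom/Autˡ-finite p q)
    where
    module G = Group (Aut q)
    open GroupProperties (Aut q) using (inverseʳ-unique; ⁻¹-involutive)
    open SetoidReasoning (homSetoid p q)
    cancel : ∀ {β γ} (f : Hom p q) → β ⊚ f ≋ₕ γ ⊚ f → β ≋ₕ γ
    -- Freeness is given as triviality of stabilisers, so it is applied to `γ ⁻¹ ⊚ β`, which fixes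
    -- `f`.
    cancel {β} {γ} f βf≈γf = G.trans (inverseʳ-unique _ _ (freeˡ eq (γ ⁻¹ ⊚ β) f (begin
      (γ ⁻¹ ⊚ β) ⊚ f    ≈⟨ assoc _ _ _ ⟩
      γ ⁻¹ ⊚ (β ⊚ f)    ≈⟨ ∘-cong G.refl βf≈γf ⟩
      γ ⁻¹ ⊚ (γ ⊚ f)    ≈⟨ assoc _ _ _ ⟨
      (γ ⁻¹ ⊚ γ) ⊚ f    ≈⟨ ∘-cong (G.inverseˡ γ) H.refl ⟩
      id ⊚ f            ≈⟨ identityˡ f ⟩
      f                 ∎))) (⁻¹-involutive γ)

  ∣Hom∣≡d*∣Aut∣ : ∀ {p q} → rank q ≡ rank p ℕ.+ 1 →
                  ∣ hom-finite p q ∣ ≡ d p q ℕ.* ∣Aut p ∣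
  ∣Hom∣≡d*∣Aut∣ {p} {q} eq = ∣set∣≡∣orbits∣*∣group∣ (λ α f → f ⊚ α)
    (λ f α≈γ → ∘-cong H.refl α≈γ) cancel ~ʳ-isEquivalence
    (hom-finite p p) (hom-finite p q) (Hom/Autʳ-finite p q)
    where
    module G = Group (Aut p)
    open SetoidReasoning (homSetoid p q)
    cancel : ∀ {α γ} (f : Hom p q) → f ⊚ α ≋ₕ f ⊚ γ → α ≋ₕ γ
    -- Precomposition acts on the right, so the stabilising element has its inverse on the right.
    cancel {α} {γ} f fα≈fγ = GroupProperties.x∙y⁻¹≈ε⇒x≈y (Aut p) α γ (freeʳ eq (α ⊚ γ ⁻¹) f (begin
      f ⊚ (α ⊚ γ ⁻¹)    ≈⟨ assoc _ _ _ ⟨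
      (f ⊚ α) ⊚ γ ⁻¹    ≈⟨ ∘-cong fα≈fγ G.refl ⟩
      (f ⊚ γ) ⊚ γ ⁻¹    ≈⟨ assoc _ _ _ ⟩
      f ⊚ (γ ⊚ γ ⁻¹)    ≈⟨ ∘-cong H.refl (G.inverseʳ γ) ⟩
      f ⊚ id            ≈⟨ identityʳ f ⟩
      f                 ∎))

-- Finite sums with at most one nonzero term.

module _ (M : CommutativeMonoid c ℓ) where
  open CommutativeMonoid M
  open CommutativeMonoidSum M

  sum-zero : ∀ {n} (t : Fin n → Carrier) → (∀ i → t i ≈ ε) → sum t ≈ ε
  sum-zero {n} t t≈ε = trans (sum-cong-≋ t≈ε) (sum-replicate-zero n)

  sum-single : ∀ {n} (t : Fin n → Carrier) i → (∀ j → j ≢ i → t j ≈ ε) → sum t ≈ t i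
  sum-single {suc n} t i t≈ε = trans (sum-remove {i = i} t)
    (trans (∙-congˡ (sum-zero _ (λ j → t≈ε _ (punchInᵢ≢i i j)))) (identityʳ _))

-- Pairing an object with a sum over a rank.

module _ (C : UpdownCategory o h ℓ) (k : HeytingField c ℓ₁ ℓ₂) where
  open UpdownCategory C using (Ob; rank; rank-finite; _≟_; u; d; ∣Aut_∣; hom-finite)
  open Operators k C
  open CommutativeRing (fieldRing k) hiding (zero)
  open LeftModule k[Ob] using (Carrierᴹ; _*ₗ_; _+ᴹ_; +ᴹ-rawMonoid)
  open RawMonoidDefinitions +ᴹ-rawMonoid using () renaming (sum to sumᴹ)
  open CommutativeMonoidSum +-commutativeMonoid using (sum)
  open SemiringMult semiring using (×1-homo-*) renaming (_×_ to _·_)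
  open SetoidReasoning setoid

  private
    -- Pairing with a bare object avoids the coefficient `1#` of `basis p`, and is the form in which
    -- `bilinear` unfolds.
    ⟨_∣_⟩ : Ob → Carrierᴹ → Carrier
    ⟨ p ∣ y ⟩ = extend regularModule ⟨ p ,_⟩-ob y

    at : ∀ n → Fin (∣ rank-finite n ∣) → Ob
    at n i = proj₁ (Inverse.from (proj₂ (rank-finite n)) i)

  ⟨⟩-ob-refl : ∀ p → ⟨ p , p ⟩-ob ≡ ∣Aut p ∣ · 1#
  ⟨⟩-ob-refl p with p ≟ p
  ... | yes _   = ≡.refl
  ... | no  p≢p = contradiction ≡.refl p≢p

  ⟨⟩-ob-≢ : ∀ {p q} → q ≢ p → ⟨ p , q ⟩-ob ≡ 0#
  ⟨⟩-ob-≢ {p} {q} q≢p with q ≟ p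
  ... | yes q≡p = contradiction q≡p q≢p
  ... | no  _   = ≡.refl

  *-⟨⟩-ob-≢ : ∀ s {p q} → q ≢ p → s * ⟨ p , q ⟩-ob ≈ 0#
  *-⟨⟩-ob-≢ s q≢p = trans (*-congˡ (reflexive (⟨⟩-ob-≢ q≢p))) (zeroʳ s)

  extend-∑Rank : ∀ g n (f : Ob → Carrier) →
    extend regularModule g (∑Rank n λ p → f p *ₗ basis p) ≈ sum (λ i → f (at n i) * g (at n i))
  extend-∑Rank g n f = go (at n)
    where
    -- The induction on the number of terms needs an arbitrary family of objects in place of the
    -- enumeration `at n`.
    go : ∀ {m} (p : Fin m → Ob) → extend regularModule g (sumᴹ (λ i → f (p i) *ₗ basis (p i)))
           ≈ sum (λ i → f (p i) * g (p i))
    go {zero}  p = refl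
    go {suc m} p = +-cong (*-congʳ (*-identityʳ _)) (go (p ∘ Fin.suc))

  -- Distinct objects are orthogonal, so only the summand at `q` survives. Taking `f` to be `u p` or
  -- `λ p′ → d p′ q` evaluates the two sides of the adjunction.
  ∑Rank-pairing : ∀ n (f : Ob → ℕ) q → rank q ≡ n →
    ⟨ q ∣ ∑Rank n (λ p → (f p · 1#) *ₗ basis p) ⟩ ≈ (f q ℕ.* ∣Aut q ∣) · 1#
  ∑Rank-pairing n f q rq≡n = begin
    ⟨ q ∣ ∑Rank n (λ p → (f p · 1#) *ₗ basis p) ⟩   ≈⟨ extend-∑Rank ⟨ q ,_⟩-ob n (λ p → f p · 1#) ⟩
    sum (term ∘ at n)                               ≈⟨ sum-single +-commutativeMonoid (term ∘ at n) i off-i ⟩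
    term (at n i)                                   ≡⟨ ≡.cong term at-i ⟩
    (f q · 1#) * ⟨ q , q ⟩-ob                       ≡⟨ ≡.cong (f q · 1# *_) (⟨⟩-ob-refl q) ⟩
    (f q · 1#) * (∣Aut q ∣ · 1#)                    ≈⟨ ×1-homo-* (f q) ∣Aut q ∣ ⟨
    (f q ℕ.* ∣Aut q ∣) · 1#                         ∎
    where
    module R↔ = Inverse (proj₂ (rank-finite n))
    term : Ob → Carrier
    term p = (f p · 1#) * ⟨ q , p ⟩-ob
    i : Fin ∣ rank-finite n ∣
    i = R↔.to (q , rq≡n)
    at-i : at n i ≡ q
    at-i = ≡.cong proj₁ (R↔.strictlyInverseʳ (q , rq≡n))
    at-injective : ∀ {j} → at n j ≡ q → j ≡ i
    -- Elements of `Rank n` carry a proof of their rank; irrelevance of equality in `ℕ` identifies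
    -- the two proofs for `q`.
    at-injective {j} ≡.refl = ≡.trans (≡.sym (R↔.strictlyInverseˡ j))
      (≡.cong (λ eq → R↔.to (q , eq)) (ℕ.≡-irrelevant _ _))
    off-i : ∀ j → j ≢ i → term (at n j) ≈ 0#
    off-i j j≢i = *-⟨⟩-ob-≢ _ (j≢i ∘ at-injective)

  ∑Rank-pairing-≢ : ∀ n (f : Ob → ℕ) q → rank q ≢ n →
    ⟨ q ∣ ∑Rank n (λ p → (f p · 1#) *ₗ basis p) ⟩ ≈ 0#
  ∑Rank-pairing-≢ n f q rq≢n = trans (extend-∑Rank ⟨ q ,_⟩-ob n (λ p → f p · 1#))
    (sum-zero +-commutativeMonoid (λ i → (f (at n i) · 1#) * ⟨ q , at n i ⟩-ob) λ i →
      *-⟨⟩-ob-≢ _ λ at≡q → rq≢n (≡.trans (≡.cong rank (≡.sym at≡q))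
        (proj₂ (Inverse.from (proj₂ (rank-finite n)) i))))

  -- Adjointness on objects, then by linearity.

  U-D-adjoint-ob : ∀ p q → ⟨ q ∣ U-ob p ⟩ ≈ ⟨ p ∣ D-ob q ⟩
  U-D-adjoint-ob p q with rank q ℕ.≟ rank p ℕ.+ 1
  ... | yes rq≡rp+1 = begin
    ⟨ q ∣ U-ob p ⟩                 ≈⟨ ∑Rank-pairing _ (u p) q rq≡rp+1 ⟩
    (u p q ℕ.* ∣Aut q ∣) · 1#      ≡⟨ ≡.cong (_· 1#) (∣Hom∣≡u*∣Aut∣ C rq≡rp+1) ⟨
    ∣ hom-finite p q ∣ · 1#        ≡⟨ ≡.cong (_· 1#) (∣Hom∣≡d*∣Aut∣ C rq≡rp+1) ⟩
    (d p q ℕ.* ∣Aut p ∣) · 1#      ≈⟨ D-side ⟨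
    ⟨ p ∣ D-ob q ⟩                 ∎
    where
    rq≡1+rp : rank q ≡ suc (rank p)
    rq≡1+rp = ≡.trans rq≡rp+1 (ℕ.+-comm (rank p) 1)
    D-side : ⟨ p ∣ D-ob q ⟩ ≈ (d p q ℕ.* ∣Aut p ∣) · 1#
    -- `D-ob q` branches on `rank q`; abstracting the rank together with its equation exposes the
    -- sum over rank `n` and excludes rank zero.
    D-side with rank q | rq≡1+rp
    ... | suc n | eq = ∑Rank-pairing n (λ p′ → d p′ q) p (≡.sym (ℕ.suc-injective eq))
  ... | no rq≢rp+1 = trans (∑Rank-pairing-≢ _ (u p) q rq≢rp+1) (sym D-side)
    where
    rq≢1+rp : rank q ≢ suc (rank p)
    rq≢1+rp eq = rq≢rp+1 (≡.trans eq (ℕ.+-comm 1 (rank p)))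
    D-side : ⟨ p ∣ D-ob q ⟩ ≈ 0#
    D-side with rank q | rq≢1+rp
    -- In rank zero `D-ob q` is the empty combination, whose pairing computes to `0#`.
    ... | zero  | _  = refl
    ... | suc n | ne = ∑Rank-pairing-≢ n (λ p′ → d p′ q) p (λ eq → ne (≡.cong suc (≡.sym eq)))

  -- Both `U` and `D` take a nonempty combination to one of the form `c *ₗ v +ᴹ w` by computation,
  -- so this is the linearity step of each induction below.
  extend-*ₗ-+ᴹ : ∀ g c v w →
    extend regularModule g (c *ₗ v +ᴹ w) ≈ c * extend regularModule g v + extend regularModule g w
  extend-*ₗ-+ᴹ g c v w = trans (extend-++ regularModule g (c *ₗ v) w)
    (+-congʳ (extend-scale regularModule g c v))

  -- The form unfolds along its first argument, so `y` is placed there for the induction; `⟨⟩-sym`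
  -- restores the order in `U-D-adjoint`.
  U-ob-adjoint : ∀ p y → ⟨ y , U-ob p ⟩ ≈ ⟨ p ∣ D y ⟩
  U-ob-adjoint p []            = refl
  U-ob-adjoint p ((c , q) ∷ y) = begin
    c * ⟨ q ∣ U-ob p ⟩ + ⟨ y , U-ob p ⟩   ≈⟨ +-cong (*-congˡ (U-D-adjoint-ob p q)) (U-ob-adjoint p y) ⟩
    c * ⟨ p ∣ D-ob q ⟩ + ⟨ p ∣ D y ⟩      ≈⟨ extend-*ₗ-+ᴹ ⟨ p ,_⟩-ob c (D-ob q) (D y) ⟨
    ⟨ p ∣ D ((c , q) ∷ y) ⟩               ∎

  U-D-adjoint : ∀ x y → ⟨ U x , y ⟩ ≈ ⟨ x , D y ⟩
  U-D-adjoint []            y = refl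
  U-D-adjoint ((c , p) ∷ x) y = begin
    ⟨ c *ₗ U-ob p +ᴹ U x , y ⟩            ≈⟨ extend-*ₗ-+ᴹ (λ q → ⟨ q ∣ y ⟩) c (U-ob p) (U x) ⟩
    c * ⟨ U-ob p , y ⟩ + ⟨ U x , y ⟩      ≈⟨ +-cong (*-congˡ (trans (⟨⟩-sym (U-ob p) y) (U-ob-adjoint p y))) (U-D-adjoint x y) ⟩
    c * ⟨ p ∣ D y ⟩ + ⟨ x , D y ⟩         ∎

theorem2p1 : ∀ {o h ℓ c ℓ₁ ℓ₂ : Level} (C : UpdownCategory o h ℓ)
    (k : HeytingField c ℓ₁ ℓ₂) → CharacteristicZero k →
    let open Operators k C in let open HeytingField k in
    (x y : LeftModule.Carrierᴹ k[Ob]) → ⟨ U x , y ⟩ ≈ ⟨ x , D y ⟩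
theorem2p1 C k _ = U-D-adjoint C k
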